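{- Let $G$ and $G'$ be finite connected multigraphs. If the simplicial complexes $\mathfrak{M}(G)$ and $\mathfrak{M}(G')$ (the complexes of discrete Morse functions of $G$ and of $G'$) are isomorphic, then $G$ and $G'$ are isomorphic multigraphs.
   Context: A multigraph $G$ is a triple $(V_G,E_G,f_G)$ with $V_G$ a finite set of vertices, $E_G$ a finite set of edges, and $f_G:E_G\to\{\{u,v\}:u,v\in V_G,\ u\ne v\}$ a map assigning to each edge its two boundary vertices. So there are no loops, but parallel edges (distinct edges with the same image under $f_G$) are allowed. Connected multigraphs are nonempty. An isomorphism $G\to G'$ is a pair of bijections $V_G\to V_{G'}$, $E_G\to E_{G'}$ compatible with the boundary maps. Regard $G$ as a $1$-dimensional regular CW-complex whose cells are the elements of $V_G\cup E_G$; write $v\prec e$ if $v\in f_G(e)$. A discrete Morse function on $G$ is a map $h:V_G\cup E_G\to\mathbb{R}$ such that for every cell $\sigma$: $|\{\tau\succ\sigma: h(\tau)\le h(\sigma)\}|\le 1$ and $|\{\nu\prec\sigma: h(\nu)\ge h(\sigma)\}|\le 1$. Its regular pairs are the pairs $(v,e)$ with $v\prec e$ and $h(v)\ge h(e)$. Functions with the same regular pairs are not distinguished. A primitive Morse function is one with exactly one regular pair, and it is identified with that pair $(v,e)$. $\mathfrak{M}(G)$ is the simplicial complex whose vertices are the primitive Morse functions on $G$, i.e. the pairs $(v,e)$ with $v\prec e$, and whose simplices are the nonempty sets of such pairs that are exactly the set of regular pairs of some discrete Morse function on $G$. Equivalently, regarding $(v,e)$ as the edge $e$ directed away from $v$,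 a nonempty set of directed edges is a simplex iff no edge of $G$ is used in both directions, no vertex is the source of two of the directed edges, and the directed edges contain no directed cycle. -}

module Defs where

open import Data.Empty using (⊥-elim)
open import Data.Fin using (Fin; zero; suc)
open import Data.Fin.Properties using (_≟_)
open import Data.Fin.Subset using (Subset; ∣_∣; _∈_)
open import Data.List using (List; []; [_]; map)
open import Data.List.Membership.Propositional using () renaming (_∈_ to _∈ˡ_)
open import Data.List.Membership.Propositional.Properties using (∈-map⁺; ∈-map⁻)
open import Data.List.Relation.Binary.Subset.Propositional using (_⊆_)
open import Data.List.Relation.Unary.Any using (here)
open import Data.List.Membership.DecPropositional using (_∈?_)
open import Data.Nat using (ℕ)
open import Data.Product using (∃; _×_; _,_; proj₁; proj₂)
open import Data.Rational using (ℚ; _<_; 0ℚ; 1ℚ; _+_; _-_; -_) renaming (_≤_ to _≤ℚ_; _⊔_ to _ℚ⊔_)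
open import Data.Rational.Properties as ℚ using ()
open import Data.Sum using (_⊎_; inj₁; inj₂)
open import Data.Vec.Properties.WithK using ([]=-irrelevant)
open import Function using (_↔_; _⇔_; mk⇔; Inverse; Equivalence)
open import Level using (Level; _⊔_; 0ℓ) renaming (suc to lsuc)
open import Relation.Binary.Construct.Closure.ReflexiveTransitive using (Star)
open import Relation.Binary.PropositionalEquality using (_≡_; _≢_; refl; sym; cong; subst)
open import Relation.Nullary using (¬_; yes; no; contradiction)
open import Relation.Nullary.Decidable using (toWitness; toWitnessFalse)
open import Relation.Unary using (Pred)

AtMostOne : ∀ {a p} {A : Set a} → Pred A p → Set (a ⊔ p)
AtMostOne P = ∀ x y → P x → P y → x ≡ y

-- Two-sided Dedekind cuts of ℚ; _≤_ below is inclusion of lower cuts.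
record ℝ : Set₁ where
  field
    Lower        : Pred ℚ 0ℓ
    Upper        : Pred ℚ 0ℓ
    inhabitedˡ   : ∃ Lower
    inhabitedᵘ   : ∃ Upper
    roundedˡ     : ∀ q → Lower q ⇔ (∃ λ r → q < r × Lower r)
    roundedᵘ     : ∀ r → Upper r ⇔ (∃ λ q → q < r × Upper q)
    disjoint     : ∀ q → ¬ (Lower q × Upper q)
    located      : ∀ {q r} → q < r → Lower q ⊎ Upper r

open ℝ

infix 4 _≤_

_≤_ : ℝ → ℝ → Set
x ≤ y = ∀ q → Lower x q → Lower y q

fromℚ : ℚ → ℝ
fromℚ p = record
  { Lower      = λ q → q < p
  ; Upper      = λ q → p < q
  ; inhabitedˡ = p - 1ℚ , subst (p - 1ℚ <_) (ℚ.+-identityʳ p)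
                            (ℚ.+-monoʳ-< p (toWitness {a? = - 1ℚ ℚ.<? 0ℚ} _))
  ; inhabitedᵘ = p + 1ℚ , subst (_< p + 1ℚ) (ℚ.+-identityʳ p)
                            (ℚ.+-monoʳ-< p (toWitness {a? = 0ℚ ℚ.<? 1ℚ} _))
  ; roundedˡ   = λ q → mk⇔ (λ q<p → let m , q<m , m<p = ℚ.<-dense q<p in m , q<m , m<p)
                           (λ (_ , q<m , m<p) → ℚ.<-trans q<m m<p)
  ; roundedᵘ   = λ q → mk⇔ (λ p<q → let m , p<m , m<q = ℚ.<-dense p<q in m , m<q , p<m)
                           (λ (_ , m<q , p<m) → ℚ.<-trans p<m m<q)
  ; disjoint   = λ q (q<p , p<q) → ℚ.<-asym q<p p<q
  ; located    = λ {q} {r} → loc q r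
  }
  where
  loc : ∀ q r → q < r → q < p ⊎ p < r
  loc q r q<r with q ℚ.<? p
  ... | yes q<p = inj₁ q<p
  ... | no  q≮p = inj₂ (ℚ.≤-<-trans (ℚ.≮⇒≥ q≮p) q<r)

fromℚ-mono-≤ : ∀ {p q} → p ≤ℚ q → fromℚ p ≤ fromℚ q
fromℚ-mono-≤ p≤q _ r<p = ℚ.<-≤-trans r<p p≤q

fromℚ-cancel-≤ : ∀ {p q} → fromℚ p ≤ fromℚ q → p ≤ℚ q
fromℚ-cancel-≤ {p} {q} p≤q = ℚ.≮⇒≥ λ q<p → ℚ.<-irrefl refl (p≤q q q<p)

Upper⇒fromℚ≰ : ∀ x {q} → Upper x q → ¬ (fromℚ q ≤ x)
Upper⇒fromℚ≰ x {q} x<q q≤x =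
  let r , r<q , x<r = Equivalence.to (roundedᵘ x q) x<q
  in disjoint x r (q≤x r r<q , x<r)

Upper-mono : ∀ x {q r} → q ≤ℚ r → Upper x q → Upper x r
Upper-mono x {q} {r} q≤r x<q =
  let s , s<q , x<s = Equivalence.to (roundedᵘ x q) x<q
  in Equivalence.from (roundedᵘ x r) (s , ℚ.<-≤-trans s<q q≤r , x<s)

upperBound : ∀ {n} (h : Fin n → ℝ) → ∃ λ q → ∀ i → Upper (h i) q
upperBound {ℕ.zero}  h = 0ℚ , λ ()
upperBound {ℕ.suc n} h with inhabitedᵘ (h zero) | upperBound (λ i → h (suc i))
... | q , h₀<q | r , hᵢ<r = q ℚ⊔ r , λ where
  zero    → Upper-mono (h zero) (ℚ.p≤p⊔q q r) h₀<q
  (suc i) → Upper-mono (h (suc i)) (ℚ.p≤q⊔p q r) (hᵢ<r i)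

record Multigraph : Set where
  field
    #V         : ℕ
    #E         : ℕ
    boundary   : Fin #E → Subset #V
    ∣boundary∣ : ∀ e → ∣ boundary e ∣ ≡ 2

  V : Set
  V = Fin #V

  E : Set
  E = Fin #E

  Adjacent : V → V → Set
  Adjacent u v = u ≢ v × ∃ λ e → u ∈ boundary e × v ∈ boundary e

Connected : Multigraph → Set
Connected G = V × (∀ u v → Star Adjacent u v)
  where open Multigraph G

infix 4 _≅ᴳ_

-- The last field says that boundary (onE e) is the image of boundary e
-- under the bijection onV.
record _≅ᴳ_ (G G′ : Multigraph) : Set where
  private
    module G  = Multigraph G
    module G′ = Multigraph G′
  field
    onV        : G.V ↔ G′.V
    onE        : G.E ↔ G′.E
    compatible : ∀ v e → v ∈ G.boundary e ⇔
                         Inverse.to onV v ∈ G′.boundary (Inverse.to onE e)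

-- A finite set of vertices is presented by a list of its elements; by
-- downward closure, order and repetitions are irrelevant.
record SimplicialComplex (a s : Level) : Set (lsuc (a ⊔ s)) where
  field
    Vertex     : Set a
    IsSimplex  : List Vertex → Set s
    nonempty   : ∀ xs → IsSimplex xs → xs ≢ []
    singleton  : ∀ x → IsSimplex [ x ]
    downClosed : ∀ xs ys → IsSimplex xs → ys ≢ [] → ys ⊆ xs → IsSimplex ys

infix 4 _≅_

record _≅_ {a b s t} (K : SimplicialComplex a s) (L : SimplicialComplex b t)
         : Set (a ⊔ b ⊔ s ⊔ t) where
  private
    module K = SimplicialComplex K
    module L = SimplicialComplex L
  field
    onVertex  : K.Vertex ↔ L.Vertex
    onSimplex : ∀ xs → K.IsSimplex xs ⇔ L.IsSimplex (map (Inverse.to onVertex) xs)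

module Morse (G : Multigraph) where
  open Multigraph G

  Cell : Set
  Cell = V ⊎ E

  infix 4 _≺_

  data _≺_ : Cell → Cell → Set where
    face : ∀ {v e} → v ∈ boundary e → inj₁ v ≺ inj₂ e

  IsDiscreteMorse : (Cell → ℝ) → Set
  IsDiscreteMorse h = ∀ σ →
    AtMostOne (λ τ → σ ≺ τ × h τ ≤ h σ) ×
    AtMostOne (λ ν → ν ≺ σ × h σ ≤ h ν)

  -- A discrete Morse function with exactly one regular pair, identified with
  -- that pair.
  record Primitive : Set where
    constructor pair
    field
      source : V
      edge   : E
      source∈edge : source ∈ boundary edge

  open Primitive

  Regular : (Cell → ℝ) → Pred Primitive 0ℓ
  Regular h p = h (inj₂ (edge p)) ≤ h (inj₁ (source p))

  HasRegularPairs : (Cell → ℝ) → List Primitive → Set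
  HasRegularPairs h ps = ∀ p → p ∈ˡ ps ⇔ Regular h p

  IsMorseSimplex : List Primitive → Set₁
  IsMorseSimplex ps =
    ps ≢ [] × ∃ λ h → IsDiscreteMorse h × HasRegularPairs h ps

  Primitive-≡ : ∀ {p q} → source p ≡ source q → edge p ≡ edge q → p ≡ q
  Primitive-≡ {pair v e i} {pair v e j} refl refl =
    cong (pair v e) ([]=-irrelevant i j)

  atMostOne⇒morse : ∀ h →
    (∀ p q → Regular h p → Regular h q → source p ≡ source q → edge p ≡ edge q) →
    (∀ p q → Regular h p → Regular h q → edge p ≡ edge q → source p ≡ source q) →
    IsDiscreteMorse h
  atMostOne⇒morse h out in′ (inj₁ v) =
    (λ { _ _ (face i , r) (face j , s) →
           cong inj₂ (out (pair _ _ i) (pair _ _ j) r s refl) }) ,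
    (λ { _ _ (() , _) _ })
  atMostOne⇒morse h out in′ (inj₂ e) =
    (λ { _ _ (() , _) _ }) ,
    (λ { _ _ (face i , r) (face j , s) →
           cong inj₁ (in′ (pair _ _ i) (pair _ _ j) r s refl) })

  morse⇒sameEdge : ∀ h → IsDiscreteMorse h →
    ∀ p q → Regular h p → Regular h q → source p ≡ source q → edge p ≡ edge q
  morse⇒sameEdge h m (pair v e i) (pair .v f j) r s refl
    with proj₁ (m (inj₁ v)) (inj₂ e) (inj₂ f) (face i , r) (face j , s)
  ... | refl = refl

  morse⇒sameSource : ∀ h → IsDiscreteMorse h →
    ∀ p q → Regular h p → Regular h q → edge p ≡ edge q → source p ≡ source q
  morse⇒sameSource h m (pair v e i) (pair w .e j) r s refl
    with proj₂ (m (inj₂ e)) (inj₁ v) (inj₁ w) (face i , r) (face j , s)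
  ... | refl = refl

  -- The chosen edge and its source have value 1, all other vertices 0 and all
  -- other edges 2.
  singletonSimplex : ∀ p → IsMorseSimplex [ p ]
  singletonSimplex p = (λ ()) , h ,
    atMostOne⇒morse h
      (λ q r q-reg r-reg _ → cong edge (both q r q-reg r-reg))
      (λ q r q-reg r-reg _ → cong source (both q r q-reg r-reg)) ,
    λ q → mk⇔ (λ { (here refl) → p-regular }) (λ q-reg → here (regular⇒≡ q q-reg))
    where
    2ℚ = 1ℚ + 1ℚ

    value : Cell → ℚ
    value (inj₁ v) with v ≟ source p
    ... | yes _ = 1ℚ
    ... | no  _ = 0ℚ
    value (inj₂ e) with e ≟ edge p
    ... | yes _ = 1ℚ
    ... | no  _ = 2ℚ

    h : Cell → ℝ
    h σ = fromℚ (value σ)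

    p-regular : Regular h p
    p-regular with source p ≟ source p | edge p ≟ edge p
    ... | no s≢s | _      = contradiction refl s≢s
    ... | yes _  | no e≢e = contradiction refl e≢e
    ... | yes _  | yes _  = λ _ q<1 → q<1

    regular⇒≡ : ∀ q → Regular h q → q ≡ p
    regular⇒≡ q reg with source q ≟ source p | edge q ≟ edge p
    ... | yes s≡ | yes e≡ = Primitive-≡ s≡ e≡
    ... | yes _  | no  _  =
      contradiction (fromℚ-cancel-≤ reg) (toWitnessFalse {a? = 2ℚ ℚ.≤? 1ℚ} _)
    ... | no  _  | yes _  =
      contradiction (fromℚ-cancel-≤ reg) (toWitnessFalse {a? = 1ℚ ℚ.≤? 0ℚ} _)
    ... | no  _  | no  _  =
      contradiction (fromℚ-cancel-≤ reg) (toWitnessFalse {a? = 2ℚ ℚ.≤? 0ℚ} _)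

    both : ∀ q r → Regular h q → Regular h r → q ≡ r
    both q r q-reg r-reg
      rewrite regular⇒≡ q q-reg | regular⇒≡ r r-reg = refl

  -- Edges that are no longer used are raised above all vertex values.
  morseSimplex-downClosed : ∀ ps qs →
    IsMorseSimplex ps → qs ≢ [] → qs ⊆ ps → IsMorseSimplex qs
  morseSimplex-downClosed ps qs (_ , h , morse , hasPs) qs≢[] qs⊆ps =
    qs≢[] , h′ ,
    atMostOne⇒morse h′
      (λ q r q-reg r-reg →
        morse⇒sameEdge h morse q r (h′⇒h q q-reg) (h′⇒h r r-reg))
      (λ q r q-reg r-reg →
        morse⇒sameSource h morse q r (h′⇒h q q-reg) (h′⇒h r r-reg)) ,
    λ q → mk⇔ (qs⇒h′ q) (h′⇒qs q)
    where
    bound = upperBound (λ v → h (inj₁ v))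

    h′ : Cell → ℝ
    h′ (inj₁ v) = h (inj₁ v)
    h′ (inj₂ e) with _∈?_ _≟_ e (map edge qs)
    ... | yes _ = h (inj₂ e)
    ... | no  _ = fromℚ (proj₁ bound)

    ps⇒h : ∀ {q} → q ∈ˡ ps → Regular h q
    ps⇒h {q} = Equivalence.to (hasPs q)

    h′⇒h : ∀ q → Regular h′ q → Regular h q
    h′⇒h q reg with _∈?_ _≟_ (edge q) (map edge qs)
    ... | yes _ = reg
    ... | no  _ = ⊥-elim (Upper⇒fromℚ≰ (h (inj₁ (source q))) (proj₂ bound (source q)) reg)

    h′⇒qs : ∀ q → Regular h′ q → q ∈ˡ qs
    h′⇒qs q reg with _∈?_ _≟_ (edge q) (map edge qs)
    ... | no  _ = ⊥-elim (Upper⇒fromℚ≰ (h (inj₁ (source q))) (proj₂ bound (source q)) reg)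
    ... | yes e∈ with ∈-map⁻ edge e∈
    ...   | r , r∈ , e≡ = subst (_∈ˡ qs)
      (sym (Primitive-≡ (morse⇒sameSource h morse q r reg (ps⇒h (qs⊆ps r∈)) e≡) e≡)) r∈

    qs⇒h′ : ∀ q → q ∈ˡ qs → Regular h′ q
    qs⇒h′ q q∈ with _∈?_ _≟_ (edge q) (map edge qs)
    ... | yes _ = ps⇒h (qs⊆ps q∈)
    ... | no e∉ = ⊥-elim (e∉ (∈-map⁺ edge q∈))

𝔐 : Multigraph → SimplicialComplex 0ℓ (lsuc 0ℓ)
𝔐 G = record
  { Vertex     = Primitive
  ; IsSimplex  = IsMorseSimplex
  ; nonempty   = λ _ → proj₁
  ; singleton  = singletonSimplex
  ; downClosed = morseSimplex-downClosed
  }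
  where open Morse G

{-# OPTIONS --safe #-}
-- Regard a primitive Morse function as a half-edge p = (v , e).  Two distinct
-- half-edges span a simplex unless they have the same source or traverse the
-- same pair of vertices in opposite directions, so an isomorphism of Morse
-- complexes preserves this "conflict" relation; the relation alone determines G.
-- If not all half-edges are in conflict, parallel half-edges are exactly the
-- twins of the conflict graph.  A half-edge p and its opposite have no common
-- neighbour up to twins, and two non-parallel half-edges with the same source
-- share this property only if their source has just two neighbours.  Hence, by
-- connectedness, an isomorphism f either respects opposite pairs everywhere,
-- and then it induces an isomorphism of graphs, or nowhere.  In the latter case
-- G is a cycle (with edges multiplied uniformly) and f exchanges vertices with
-- classes of parallel edges; precomposing f with a rotation of the cycle by one
-- half-edge reduces this to the former case.
module Submission where

open import Data.Bool using (Bool; true; false; if_then_else_)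
open import Data.Fin using (Fin; zero; suc; _<_)
open import Data.Fin.Permutation using (↔⇒≡)
open import Data.Fin.Properties using (_≟_; <-cmp; <-asym; all?; any?; +↔⊎)
  renaming (suc-injective to Fin-suc-injective)
open import Data.Fin.Subset using (Subset; ∣_∣; _∈_; _∉_; inside; outside)
open import Data.List using ([]; _∷_)
open import Data.List.Membership.Propositional using () renaming (_∈_ to _∈ˡ_)
open import Data.List.Relation.Unary.Any using (here; there)
open import Data.Nat using (ℕ; zero; suc; _+_)
open import Data.Nat.Properties using (suc-injective; *-cancelˡ-≡; +-identityʳ)
open import Data.Product using (∃; _×_; _,_; proj₁; proj₂)
open import Data.Rational as ℚ using (ℚ; 0ℚ; 1ℚ)
import Data.Rational.Properties as ℚ
open import Data.Sum using (_⊎_; inj₁; inj₂; [_,_]′) renaming (map to map⊎; swap to swap⊎)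
open import Data.Unit using (⊤; tt)
open import Data.Vec using ([]; _∷_; here; there)
open import Function using (_↔_; _⇔_; mk⇔; mk↔ₛ′; Inverse; Equivalence; _∘_; id)
open import Function.Construct.Composition using (_↔-∘_)
open import Function.Construct.Identity using (↔-id)
open import Function.Construct.Symmetry using (↔-sym)
open import Level using (0ℓ)
open import Relation.Binary.Construct.Closure.ReflexiveTransitive using (Star; ε; _◅_)
open import Relation.Binary.Definitions using (tri<; tri≈; tri>)
open import Relation.Binary.PropositionalEquality
  using (_≡_; _≢_; refl; sym; trans; cong; subst; subst₂)
open import Relation.Nullary using (¬_; Dec; does; yes; no; contradiction)
open import Relation.Nullary.Decidable
  using (_⊎-dec_; _×-dec_; map′; dec-true; dec-false; toWitnessFalse; decidable-stable)
open import Relation.Unary using (Pred)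

open import Defs

-- Comparison of real numbers.

module _ where
  open ℝ

  -- For `q` below `y`, pick `r > q` still below `y`. Locatedness puts `q` below `x` or `x` below
  -- `r`, and the latter would give `x ≤ y`.
  ≰⇒≥ : ∀ x y → ¬ (x ≤ y) → y ≤ x
  ≰⇒≥ x y x≰y q y>q with Equivalence.to (roundedˡ y q) y>q
  ... | r , q<r , y>r with located x q<r
  ...   | inj₁ x>q = x>q
  ...   | inj₂ x<r = contradiction x≤y x≰y
    where
    x≤y : x ≤ y
    x≤y s x>s with s ℚ.<? r
    ... | yes s<r = Equivalence.from (roundedˡ y s) (r , s<r , y>r)
    ... | no  s≮r = contradiction (x>s , Upper-mono x (ℚ.≮⇒≥ s≮r) x<r) (disjoint x s)

-- Two-element subsets.

∣s∣≡0⇒∉ : ∀ {n} (s : Subset n) → ∣ s ∣ ≡ 0 → ∀ {x} → x ∉ s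
∣s∣≡0⇒∉ (outside ∷ s) ∣s∣ (there x∈s) = ∣s∣≡0⇒∉ s ∣s∣ x∈s

∣s∣≡1⇒∃! : ∀ {n} (s : Subset n) → ∣ s ∣ ≡ 1 →
           ∃ λ x → x ∈ s × (∀ {y} → y ∈ s → y ≡ x)
∣s∣≡1⇒∃! (outside ∷ s) ∣s∣ =
  let x , x∈s , only = ∣s∣≡1⇒∃! s ∣s∣
  in suc x , there x∈s , λ { (there y∈s) → cong suc (only y∈s) }
∣s∣≡1⇒∃! (inside ∷ s) ∣s∣ = zero , here , λ where
  here        → refl
  (there y∈s) → contradiction y∈s (∣s∣≡0⇒∉ s (suc-injective ∣s∣))

∣s∣≡2⇒other : ∀ {n} (s : Subset n) → ∣ s ∣ ≡ 2 → ∀ {x} → x ∈ s →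
              ∃ λ y → y ∈ s × x ≢ y × (∀ {z} → z ∈ s → z ≡ x ⊎ z ≡ y)
∣s∣≡2⇒other (outside ∷ s) ∣s∣ (there x∈s) =
  let y , y∈s , x≢y , only = ∣s∣≡2⇒other s ∣s∣ x∈s
  in suc y , there y∈s , x≢y ∘ Fin-suc-injective ,
     λ { (there z∈s) → map⊎ (cong suc) (cong suc) (only z∈s) }
∣s∣≡2⇒other (inside ∷ s) ∣s∣ here =
  let y , y∈s , only = ∣s∣≡1⇒∃! s (suc-injective ∣s∣)
  in suc y , there y∈s , (λ ()) , λ where
       here        → inj₁ refl
       (there z∈s) → inj₂ (cong suc (only z∈s))
∣s∣≡2⇒other (inside ∷ s) ∣s∣ (there x∈s) =
  let y , _ , only = ∣s∣≡1⇒∃! s (suc-injective ∣s∣)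
  in zero , here , (λ ()) , λ where
       here        → inj₂ refl
       (there z∈s) → inj₁ (cong suc (trans (only z∈s) (sym (only x∈s))))

∣s∣≡2⇒∃ : ∀ {n} (s : Subset n) → ∣ s ∣ ≡ 2 → ∃ (_∈ s)
∣s∣≡2⇒∃ (outside ∷ s) ∣s∣ = let x , x∈s = ∣s∣≡2⇒∃ s ∣s∣ in suc x , there x∈s
∣s∣≡2⇒∃ (inside ∷ s) ∣s∣ = zero , here

-- Half-edges and their conflicts.

module HalfEdges (G : Multigraph) where
  open Multigraph G public
  open Morse G public
  open Primitive public

  private
    other : (p : Primitive) → _
    other p = ∣s∣≡2⇒other (boundary (edge p)) (∣boundary∣ (edge p)) (source∈edge p)

  target : Primitive → V
  target p = proj₁ (other p)

  opp : Primitive → Primitive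
  opp p = pair (target p) (edge p) (proj₁ (proj₂ (other p)))

  source≢target : ∀ p → source p ≢ target p
  source≢target p = proj₁ (proj₂ (proj₂ (other p)))

  ∈edge : ∀ p {v} → v ∈ boundary (edge p) → v ≡ source p ⊎ v ≡ target p
  ∈edge p = proj₂ (proj₂ (proj₂ (other p)))

  target-opp : ∀ p → target (opp p) ≡ source p
  target-opp p with ∈edge p (source∈edge (opp (opp p)))
  ... | inj₁ eq = eq
  ... | inj₂ eq = contradiction (sym eq) (source≢target (opp p))

  opp-involutive : ∀ p → opp (opp p) ≡ p
  opp-involutive p = Primitive-≡ (target-opp p) refl

  sameEdge : ∀ p q → edge p ≡ edge q → p ≡ q ⊎ p ≡ opp q
  sameEdge p q eq = map⊎ (λ s → Primitive-≡ s eq) (λ s → Primitive-≡ s eq)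
    (∈edge q (subst (λ e → source p ∈ boundary e) eq (source∈edge p)))

  onEdge : ∀ e → ∃ λ p → edge p ≡ e
  onEdge e = let v , v∈e = ∣s∣≡2⇒∃ (boundary e) (∣boundary∣ e) in pair v e v∈e , refl

  adjacent⇒halfEdge : ∀ {u v} → Adjacent u v → ∃ λ p → source p ≡ u × target p ≡ v
  adjacent⇒halfEdge {u} {v} (u≢v , e , u∈e , v∈e) with ∈edge (pair u e u∈e) v∈e
  ... | inj₁ v≡u = contradiction (sym v≡u) u≢v
  ... | inj₂ v≡t = pair u e u∈e , refl , sym v≡t

  -- These relations see only end vertices, never the edge itself: crossed half-edges may lie on one
  -- edge or on two parallel edges, where they form a directed 2-cycle. `Conflict` is reflexive.
  Parallel Crossed Conflict : Primitive → Primitive → Set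
  Parallel p q = source p ≡ source q × target p ≡ target q
  Crossed  p q = source p ≡ target q × target p ≡ source q
  Conflict p q = source p ≡ source q ⊎ Crossed p q

  Complete : Set
  Complete = ∀ p q → Conflict p q

  conflict? : ∀ p q → Dec (Conflict p q)
  conflict? p q =
    source p ≟ source q ⊎-dec (source p ≟ target q ×-dec target p ≟ source q)

  parallel-refl : ∀ p → Parallel p p
  parallel-refl p = refl , refl

  parallel-sym : ∀ p q → Parallel p q → Parallel q p
  parallel-sym _ _ (s , t) = sym s , sym t

  parallel-trans : ∀ p q r → Parallel p q → Parallel q r → Parallel p r
  parallel-trans _ _ _ (s , t) (s′ , t′) = trans s s′ , trans t t′

  parallel-opp : ∀ p q → Parallel p q → Parallel (opp p) (opp q)
  parallel-opp p q (s , t) = t , trans (target-opp p) (trans s (sym (target-opp q)))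

  crossed-opp : ∀ p → Crossed p (opp p)
  crossed-opp p = sym (target-opp p) , refl

  crossed-sym : ∀ p q → Crossed p q → Crossed q p
  crossed-sym _ _ (s , t) = sym t , sym s

  parallel-crossed : ∀ p q r → Parallel p q → Crossed q r → Crossed p r
  parallel-crossed _ _ _ (s , t) (s′ , t′) = trans s s′ , trans t t′

  crossed-crossed : ∀ p q r → Crossed p q → Crossed p r → Parallel q r
  crossed-crossed _ _ _ (s , t) (s′ , t′) = trans (sym t) t′ , trans (sym s) s′

  crossed⇒source≢ : ∀ p q → Crossed p q → source p ≢ source q
  crossed⇒source≢ p q (s , t) eq = source≢target q (trans (sym eq) s)

  parallel-conflict : ∀ p q r → Parallel p q → Conflict q r → Conflict p r
  parallel-conflict p q r (s , t) = map⊎ (trans s) (parallel-crossed p q r (s , t))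

  twoVertices⇒complete : ∀ p → (∀ v → v ≡ source p ⊎ v ≡ target p) → Complete
  twoVertices⇒complete p all q r
    with all (source q) | all (target q) | all (source r) | all (target r)
  ... | inj₁ a | _      | inj₁ c | _      = inj₁ (trans a (sym c))
  ... | inj₂ a | _      | inj₂ c | _      = inj₁ (trans a (sym c))
  ... | inj₁ a | inj₂ b | inj₂ c | inj₁ d = inj₂ (trans a (sym d) , trans b (sym c))
  ... | inj₂ a | inj₁ b | inj₁ c | inj₂ d = inj₂ (trans a (sym d) , trans b (sym c))
  ... | inj₁ a | inj₁ b | _      | _      = contradiction (trans a (sym b)) (source≢target q)
  ... | inj₂ a | inj₂ b | _      | _      = contradiction (trans a (sym b)) (source≢target q)
  ... | _      | _      | inj₁ c | inj₁ d = contradiction (trans c (sym d)) (source≢target r)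
  ... | _      | _      | inj₂ c | inj₂ d = contradiction (trans c (sym d)) (source≢target r)

  -- Connectedness and twins.

  module _ (connected : Connected G) where

    private
      _⟶⋆_ : V → V → Set
      _⟶⋆_ = Star Adjacent

    -- Each step of a walk from `source p` to `source q` is a change of half-edge at the current
    -- vertex followed by a reversal.
    halfEdge-induction : ∀ {ℓ} (Q : Pred Primitive ℓ) →
      (∀ p q → source p ≡ source q → Q p → Q q) → (∀ p → Q p → Q (opp p)) →
      ∀ p q → Q p → Q q
    halfEdge-induction Q around across p q Qp =
      walk (proj₂ connected (source p) (source q)) p refl Qp
      where
      walk : ∀ {v} → v ⟶⋆ source q → ∀ p → source p ≡ v → Q p → Q q
      walk ε p eq Qp = around p q eq Qp
      walk (step ◅ steps) p eq Qp =
        let r , sr , tr = adjacent⇒halfEdge step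
        in walk steps (opp r) tr (across r (around p r (trans eq (sym sr)) Qp))

    outgoing : Primitive → ∀ v → ∃ λ p → source p ≡ v
    outgoing p v with proj₂ connected v (source p)
    ... | ε        = p , refl
    ... | step ◅ _ = let r , sr , _ = adjacent⇒halfEdge step in r , sr

    twoVertices : ∀ p →
      (∀ r → source r ≡ source p → target r ≡ target p) →
      (∀ r → source r ≡ target p → target r ≡ source p) →
      ∀ v → v ≡ source p ⊎ v ≡ target p
    twoVertices p out back v = walk (proj₂ connected (source p) v) (inj₁ refl)
      where
      walk : ∀ {u} → u ⟶⋆ v → u ≡ source p ⊎ u ≡ target p → v ≡ source p ⊎ v ≡ target p
      walk ε at = at
      walk (step ◅ steps) at with adjacent⇒halfEdge step
      ... | r , sr , tr = walk steps
        ([ (λ eq → inj₂ (trans (sym tr) (out r (trans sr eq))))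
         , (λ eq → inj₁ (trans (sym tr) (back r (trans sr eq)))) ]′ at)

    -- A half-edge leaving one end of `p` conflicts with the half-edge of the same edge that leaves
    -- the other end. Their sources differ, so they cross, and no walk escapes from the two ends.
    complete⇒twoVertices : Complete → ∀ p v → v ≡ source p ⊎ v ≡ target p
    complete⇒twoVertices complete p = twoVertices p
      (λ r sr → [ (λ eq → contradiction (trans (sym sr) (sym eq)) (source≢target p))
                , (λ c → sym (proj₁ c)) ]′ (complete (opp p) r))
      (λ r sr → [ (λ eq → contradiction (trans eq sr) (source≢target p))
                , (λ c → sym (proj₁ c)) ]′ (complete p r))

    -- As conflict is reflexive, twins conflict with each other. If they share a source, `opp p`
    -- crosses `p`, hence also `q`. If they cross, any half-edge at an end of `p` shares its source
    -- with one twin and must cross the other, so the graph has only two vertices.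
    twin⇒parallel : ¬ Complete → ∀ p q → (∀ r → Conflict p r ⇔ Conflict q r) → Parallel p q
    twin⇒parallel ¬complete p q twin with Equivalence.to (twin p) (inj₁ refl)
    ... | inj₁ sq with Equivalence.to (twin (opp p)) (inj₂ (crossed-opp p))
    ...   | inj₁ sq′ = contradiction (trans (sym sq) sq′) (source≢target p)
    ...   | inj₂ (_ , tq) = sym sq , sym tq
    twin⇒parallel ¬complete p q twin | inj₂ (sq , tq) =
      contradiction (twoVertices⇒complete p (twoVertices p out back)) ¬complete
      where
      out : ∀ r → source r ≡ source p → target r ≡ target p
      out r sr with Equivalence.to (twin r) (inj₁ (sym sr))
      ... | inj₁ eq = contradiction (trans (sym sr) (trans (sym eq) sq)) (source≢target p)
      ... | inj₂ (eq , _) = trans (sym eq) sq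

      back : ∀ r → source r ≡ target p → target r ≡ source p
      back r sr with Equivalence.from (twin r) (inj₁ (trans sq (sym sr)))
      ... | inj₁ eq = contradiction (trans eq sr) (source≢target p)
      ... | inj₂ (eq , _) = sym eq

  -- Phrased through conflict and parallelism alone, so that it can be transported along `f`.
  Isolated : Primitive → Primitive → Set
  Isolated p q = ∀ r → Conflict p r → Conflict q r → Parallel p r ⊎ Parallel q r

  -- A half-edge crossing one of `p`, `q` is parallel to the other, and none shares its source with
  -- both.
  crossed⇒isolated : ∀ p q → Crossed p q → Isolated p q
  crossed⇒isolated p q c r (inj₁ s) (inj₁ s′) =
    contradiction (trans s (sym s′)) (crossed⇒source≢ p q c)
  crossed⇒isolated p q c r (inj₁ _) (inj₂ c′) =
    inj₁ (crossed-crossed q p r (crossed-sym p q c) c′)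
  crossed⇒isolated p q c r (inj₂ c′) _ = inj₂ (crossed-crossed p q r c c′)

  -- Two-element simplices of the Morse complex.

  morse⇒¬conflict : ∀ {p q} → p ≢ q → IsMorseSimplex (p ∷ q ∷ []) → ¬ Conflict p q
  morse⇒¬conflict {p} {q} p≢q (_ , h , morse , regular) = λ where
      (inj₁ s) → p≢q (Primitive-≡ s (morse⇒sameEdge h morse p q p-regular q-regular s))
      (inj₂ (s , t)) →
        let opp-p-irregular : ¬ Regular h (opp p)
            opp-p-irregular reg = source≢target p
              (morse⇒sameSource h morse p (opp p) p-regular reg refl)
            q∥ = pair (source p) (edge q) (subst (_∈ _) (sym s) (source∈edge (opp q)))
            q∥-irregular : ¬ Regular h q∥
            q∥-irregular reg = source≢target q
              (trans (morse⇒sameSource h morse q q∥ q-regular reg refl) s)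
        -- Around the 2-cycle the values satisfy `h (edge p) ≤ h (source p) ≤ h (edge q) ≤ h (source
        -- q)`, up to injections, and `source q` is `target p`; this would make `opp p` regular.
        in opp-p-irregular λ x x<e →
             subst (λ v → ℝ.Lower (h (inj₁ v)) x) (sym t)
               (q-regular x (≰⇒≥ (h (inj₂ (edge q))) (h (inj₁ (source p))) q∥-irregular x
                 (p-regular x x<e)))
    where
    p-regular : Regular h p
    p-regular = Equivalence.to (regular p) (here refl)

    q-regular : Regular h q
    q-regular = Equivalence.to (regular q) (there (here refl))

  -- The pair p has value 2 and the pair q has value 1; all other vertices have
  -- value 0 and all other edges 3.
  pairSimplex : ∀ p q → source p ≢ source q → edge p ≢ edge q → target q ≢ source p →
                IsMorseSimplex (p ∷ q ∷ [])
  pairSimplex p q s≢ e≢ t≢ = (λ ()) , h ,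
    atMostOne⇒morse h out in′ ,
    λ r → mk⇔ (member⇒regular r) (λ reg → [ here , (λ eq → there (here eq)) ]′ (regular⇒member r reg))
    where
    2ℚ 3ℚ : ℚ
    2ℚ = 1ℚ ℚ.+ 1ℚ
    3ℚ = 2ℚ ℚ.+ 1ℚ

    value : Cell → ℚ
    value (inj₁ v) with v ≟ source p | v ≟ source q
    ... | yes _ | _     = 2ℚ
    ... | no  _ | yes _ = 1ℚ
    ... | no  _ | no  _ = 0ℚ
    value (inj₂ e) with e ≟ edge p | e ≟ edge q
    ... | yes _ | _     = 2ℚ
    ... | no  _ | yes _ = 1ℚ
    ... | no  _ | no  _ = 3ℚ

    h : Cell → ℝ
    h = fromℚ ∘ value

    member⇒regular : ∀ r → r ∈ˡ p ∷ q ∷ [] → Regular h r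
    member⇒regular .p (here refl) with source p ≟ source p | edge p ≟ edge p
    ... | yes _ | yes _ = λ _ → id
    ... | no  n | _     = contradiction refl n
    ... | _     | no n  = contradiction refl n
    member⇒regular .q (there (here refl))
      with source q ≟ source p | edge q ≟ edge p | source q ≟ source q | edge q ≟ edge q
    ... | yes s | _     | _     | _     = contradiction (sym s) s≢
    ... | _     | yes e | _     | _     = contradiction (sym e) e≢
    ... | _     | _     | no n  | _     = contradiction refl n
    ... | _     | _     | _     | no n  = contradiction refl n
    ... | no _  | no _  | yes _ | yes _ = λ _ → id

    regular⇒member : ∀ r → Regular h r → r ≡ p ⊎ r ≡ q
    regular⇒member r reg
      with source r ≟ source p | source r ≟ source q | edge r ≟ edge p | edge r ≟ edge q
    ... | yes s | _     | yes e | _     = inj₁ (Primitive-≡ s e)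
    -- The vertex value 2 exceeds the edge value 1, so only the position of `r` can help: it is `q`
    -- or `opp q`, and the latter would start at `source p` only if `q` pointed there.
    ... | yes s | _     | no _  | yes e =
      [ (λ { refl → contradiction (sym s) s≢ })
      , (λ { refl → contradiction s t≢ }) ]′ (sameEdge r q e)
    ... | yes _ | _     | no _  | no _  =
      contradiction (fromℚ-cancel-≤ reg) (toWitnessFalse {a? = 3ℚ ℚ.≤? 2ℚ} _)
    ... | no _  | yes _ | yes _ | _     =
      contradiction (fromℚ-cancel-≤ reg) (toWitnessFalse {a? = 2ℚ ℚ.≤? 1ℚ} _)
    ... | no _  | yes s | no _  | yes e = inj₂ (Primitive-≡ s e)
    ... | no _  | yes _ | no _  | no _  =
      contradiction (fromℚ-cancel-≤ reg) (toWitnessFalse {a? = 3ℚ ℚ.≤? 1ℚ} _)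
    ... | no _  | no _  | yes _ | _     =
      contradiction (fromℚ-cancel-≤ reg) (toWitnessFalse {a? = 2ℚ ℚ.≤? 0ℚ} _)
    ... | no _  | no _  | no _  | yes _ =
      contradiction (fromℚ-cancel-≤ reg) (toWitnessFalse {a? = 1ℚ ℚ.≤? 0ℚ} _)
    ... | no _  | no _  | no _  | no _  =
      contradiction (fromℚ-cancel-≤ reg) (toWitnessFalse {a? = 3ℚ ℚ.≤? 0ℚ} _)

    out : ∀ r r′ → Regular h r → Regular h r′ → source r ≡ source r′ → edge r ≡ edge r′
    out r r′ reg reg′ s with regular⇒member r reg | regular⇒member r′ reg′
    ... | inj₁ refl | inj₁ refl = refl
    ... | inj₁ refl | inj₂ refl = contradiction s s≢
    ... | inj₂ refl | inj₁ refl = contradiction (sym s) s≢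
    ... | inj₂ refl | inj₂ refl = refl

    in′ : ∀ r r′ → Regular h r → Regular h r′ → edge r ≡ edge r′ → source r ≡ source r′
    in′ r r′ reg reg′ e with regular⇒member r reg | regular⇒member r′ reg′
    ... | inj₁ refl | inj₁ refl = refl
    ... | inj₁ refl | inj₂ refl = contradiction e e≢
    ... | inj₂ refl | inj₁ refl = contradiction (sym e) e≢
    ... | inj₂ refl | inj₂ refl = refl

  sameEdge⇒conflict : ∀ p q → edge p ≡ edge q → Conflict p q
  sameEdge⇒conflict p q e with sameEdge p q e
  ... | inj₁ refl = inj₁ refl
  ... | inj₂ refl = inj₂ (refl , target-opp q)

  -- `pairSimplex` lets `p` point at the source of `q` but not conversely. If `q` points at the
  -- source of `p`, the roles are exchanged, since the two do not cross; down-closure then restores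
  -- the order of the list.
  ¬conflict⇒morse : ∀ p q → ¬ Conflict p q → IsMorseSimplex (p ∷ q ∷ [])
  ¬conflict⇒morse p q ¬c with target q ≟ source p
  ... | no t≢ = pairSimplex p q (¬c ∘ inj₁) (¬c ∘ sameEdge⇒conflict p q) t≢
  ... | yes t = morseSimplex-downClosed (q ∷ p ∷ []) (p ∷ q ∷ [])
    (pairSimplex q p (¬c ∘ inj₁ ∘ sym) (¬c ∘ sameEdge⇒conflict p q ∘ sym)
      (λ t′ → ¬c (inj₂ (sym t , t′))))
    (λ ())
    (λ { (here refl) → there (here refl) ; (there (here refl)) → here refl })

  -- Parity of half-edges on a cycle.

  -- On a cycle, opp moves along an edge and turn moves across a vertex, so the
  -- parity of the distance from a base point should 2-colour the half-edges.
  module Parity (connected : Connected G) (base : Primitive)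
    (turn : Primitive → Primitive)
    (turn-involutive : ∀ p → turn (turn p) ≡ p)
    (turn-parallel : ∀ p q → Parallel p q → Parallel (turn p) (turn q))
    (turn-∦ : ∀ p → ¬ Parallel p (turn p))
    (two-classes : ∀ p q → source p ≡ source q → Parallel p q ⊎ Parallel (turn p) q)
    where

    -- The alternating word a b a … a of length 2n + 1.
    palindrome : (a b : Primitive → Primitive) → ℕ → Primitive → Primitive
    palindrome a b zero    p = a p
    palindrome a b (suc n) p = a (palindrome b a n (a p))

    palindrome-suc : ∀ a b n p → palindrome a b (suc n) p ≡ a (b (palindrome a b n p))
    palindrome-suc a b zero    p = refl
    palindrome-suc a b (suc n) p = cong a (palindrome-suc b a n (a p))

    record Reflection (a : Primitive → Primitive) : Set where
      field
        involutive : ∀ p → a (a p) ≡ p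
        cong-∥     : ∀ p q → Parallel p q → Parallel (a p) (a q)
        moves      : ∀ p → ¬ Parallel p (a p)

    open Reflection

    opp-reflection : Reflection opp
    opp-reflection = record
      { involutive = opp-involutive
      ; cong-∥     = parallel-opp
      ; moves      = λ p → source≢target p ∘ proj₁
      }

    turn-reflection : Reflection turn
    turn-reflection = record
      { involutive = turn-involutive ; cong-∥ = turn-parallel ; moves = turn-∦ }

    -- Conjugation shortens a palindrome down to its middle letter.
    palindrome-moves : ∀ {a b} → Reflection a → Reflection b →
                       ∀ n p → ¬ Parallel p (palindrome a b n p)
    palindrome-moves A B zero p = moves A p
    palindrome-moves {a} {b} A B (suc n) p ∥ = palindrome-moves B A n (a p)
      (subst (Parallel (a p)) (involutive A _) (cong-∥ A p _ ∥))

    OddVia : (a b : Primitive → Primitive) → Pred Primitive 0ℓ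
    OddVia a b p = ∃ λ n → Parallel (palindrome a b n base) p

    -- The reduced words of odd length in two involutions are the alternating palindromes, with
    -- either letter outermost. Evenness is oddness after one more step, so words of even length are
    -- never handled.
    Odd Even : Pred Primitive 0ℓ
    Odd  p = OddVia opp turn p ⊎ OddVia turn opp p
    Even p = Odd (opp p)

    -- Prefixing `a b` to an odd word lengthens it by two or cancels its first two letters; the
    -- one-letter word `b` becomes `a`.
    extend : ∀ {a b} → Reflection a → Reflection b → ∀ p →
             OddVia a b p ⊎ OddVia b a p → OddVia a b (a (b p)) ⊎ OddVia b a (a (b p))
    extend {a} {b} A B p (inj₁ (n , ∥)) = inj₁ (suc n ,
      subst (λ q → Parallel q (a (b p))) (sym (palindrome-suc a b n base))
        (cong-∥ A _ _ (cong-∥ B _ _ ∥)))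
    extend {a} {b} A B p (inj₂ (zero , ∥)) = inj₁ (zero ,
      cong-∥ A _ _ (subst (λ q → Parallel q (b p)) (involutive B base) (cong-∥ B _ _ ∥)))
    extend {a} {b} A B p (inj₂ (suc n , ∥)) = inj₂ (n ,
      subst (λ q → Parallel q (a (b p))) (involutive A _) (cong-∥ A _ _
        (subst (λ q → Parallel q (b p)) (involutive B _) (cong-∥ B _ _
          (subst (λ q → Parallel q p) (palindrome-suc b a n base) ∥)))))

    odd-∥ : ∀ p q → Parallel p q → Odd p → Odd q
    odd-∥ p q ∥ = map⊎ extend-∥ extend-∥
      where
      extend-∥ : ∀ {a b} → OddVia a b p → OddVia a b q
      extend-∥ (n , ∥′) = n , parallel-trans _ p q ∥′ ∥

    even-∥ : ∀ p q → Parallel p q → Even p → Even q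
    even-∥ p q ∥ = odd-∥ (opp p) (opp q) (parallel-opp p q ∥)

    odd-opp : ∀ p → Odd p → Even (opp p)
    odd-opp p = subst Odd (sym (opp-involutive p))

    odd-turn : ∀ p → Odd p → Even (turn p)
    odd-turn p = extend opp-reflection turn-reflection p

    even-opp : ∀ p → Even p → Odd (opp p)
    even-opp p = id

    even-turn : ∀ p → Even p → Odd (turn p)
    even-turn p = subst (Odd ∘ turn) (opp-involutive p) ∘ swap⊎ ∘
      extend turn-reflection opp-reflection (opp p) ∘ swap⊎

    around : ∀ {Q : Pred Primitive 0ℓ} → (∀ p q → Parallel p q → Q p → Q q) →
             (∀ p → Q p → Q (turn p)) → ∀ p q → source p ≡ source q → Q p → Q q
    around Q-∥ Q-turn p q s Qp with two-classes p q s
    ... | inj₁ ∥ = Q-∥ p q ∥ Qp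
    ... | inj₂ ∥ = Q-∥ (turn p) q ∥ (Q-turn p Qp)

    -- Abstract, since with-abstraction would otherwise normalise these proofs.
    abstract
      parity : ∀ p → Even p ⊎ Odd p
      parity p = halfEdge-induction connected (λ q → Even q ⊎ Odd q)
        (around (λ q r ∥ → map⊎ (even-∥ q r ∥) (odd-∥ q r ∥))
                (λ q → swap⊎ ∘ map⊎ (even-turn q) (odd-turn q)))
        (λ q → swap⊎ ∘ map⊎ (even-opp q) (odd-opp q))
        -- `base` is even because the one-letter word `opp` leads to `opp base`.
        base p (inj₁ (inj₁ (zero , parallel-refl (opp base))))

      -- Having both parities spreads to `base`, but by `palindrome-moves` no odd word fixes `base`
      -- up to parallelism.
      even⇒¬odd : ∀ p → Even p → ¬ Odd p
      even⇒¬odd p even odd = [ absurd opp-reflection turn-reflection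
                             , absurd turn-reflection opp-reflection ]′ (proj₂ atBase)
        where
        absurd : ∀ {a b} → Reflection a → Reflection b → ¬ OddVia a b base
        absurd A B (n , ∥) = palindrome-moves A B n base (parallel-sym _ base ∥)

        atBase : Even base × Odd base
        atBase = halfEdge-induction connected (λ q → Even q × Odd q)
          (around (λ { q r ∥ (e , o) → even-∥ q r ∥ e , odd-∥ q r ∥ o })
                  (λ { q (e , o) → odd-turn q o , even-turn q e }))
          (λ { q (e , o) → odd-opp q o , even-opp q e })
          p base (even , odd)

    -- Rotation by one half-edge: taking `opp` at even and `turn` at odd half-edges alternates the
    -- two moves, hence always proceeds in one direction.
    shift unshift : Primitive → Primitive
    shift   p = [ (λ _ → opp p) , (λ _ → turn p) ]′ (parity p)
    unshift p = [ (λ _ → turn p) , (λ _ → opp p) ]′ (parity p)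

    shift-even : ∀ {p} → Even p → shift p ≡ opp p
    shift-even {p} even with parity p
    ... | inj₁ _   = refl
    ... | inj₂ odd = contradiction odd (even⇒¬odd p even)

    shift-odd : ∀ {p} → Odd p → shift p ≡ turn p
    shift-odd {p} odd with parity p
    ... | inj₁ even = contradiction odd (even⇒¬odd p even)
    ... | inj₂ _    = refl

    unshift-even : ∀ {p} → Even p → unshift p ≡ turn p
    unshift-even {p} even with parity p
    ... | inj₁ _   = refl
    ... | inj₂ odd = contradiction odd (even⇒¬odd p even)

    unshift-odd : ∀ {p} → Odd p → unshift p ≡ opp p
    unshift-odd {p} odd with parity p
    ... | inj₁ even = contradiction odd (even⇒¬odd p even)
    ... | inj₂ _    = refl

    shift-↔ : Primitive ↔ Primitive
    shift-↔ = mk↔ₛ′ shift unshift shift-unshift unshift-shift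
      where
      shift-unshift : ∀ p → shift (unshift p) ≡ p
      shift-unshift p with parity p
      ... | inj₁ even = trans (shift-odd (even-turn p even)) (turn-involutive p)
      ... | inj₂ odd  = trans (shift-even (odd-opp p odd)) (opp-involutive p)

      unshift-shift : ∀ p → unshift (shift p) ≡ p
      unshift-shift p with parity p
      ... | inj₁ even = trans (unshift-odd (even-opp p even)) (opp-involutive p)
      ... | inj₂ odd  = trans (unshift-even (odd-turn p odd)) (turn-involutive p)

  -- Representatives of edges, and degenerate graphs.

  ascending : ∀ e → ∃ λ p → edge p ≡ e × source p < target p
  ascending e with onEdge e
  ... | p , refl with <-cmp (source p) (target p)
  ...   | tri< s<t _ _ = p , refl , s<t
  ...   | tri≈ _ s≡t _ = contradiction s≡t (source≢target p)
  ...   | tri> _ _ t<s = opp p , refl , subst (target p <_) (sym (target-opp p)) t<s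

  -- The order on vertices directs parallel edges the same way, which an arbitrary choice of
  -- half-edges would not do.
  asc : E → Primitive
  asc e = proj₁ (ascending e)

  asc-edge : ∀ e → edge (asc e) ≡ e
  asc-edge e = proj₁ (proj₂ (ascending e))

  asc-< : ∀ e → source (asc e) < target (asc e)
  asc-< e = proj₂ (proj₂ (ascending e))

  ascending-unique : ∀ p q → source p < target p → source q < target q →
                     edge p ≡ edge q → p ≡ q
  ascending-unique p q p< q< e with sameEdge p q e
  ... | inj₁ p≡q  = p≡q
  ... | inj₂ refl = contradiction (subst (target q <_) (target-opp q) p<) (<-asym q<)

  halfEdge? : Dec Primitive
  halfEdge? = map′ (λ (e , _) → proj₁ (onEdge e)) (λ p → edge p , tt)
                (any? {P = λ _ → ⊤} λ _ → yes tt)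

  noHalfEdge⇒V-unique : Connected G → ¬ Primitive → ∀ u v → u ≡ v
  noHalfEdge⇒V-unique connected none u v with proj₂ connected u v
  ... | ε        = refl
  ... | step ◅ _ = contradiction (proj₁ (adjacent⇒halfEdge step)) none

  -- For counting: the number of half-edges determines the number of edges.
  E⊎E↔Primitive : (E ⊎ E) ↔ Primitive
  E⊎E↔Primitive = mk↔ₛ′ to from to-from from-to
    where
    asc≢opp : ∀ e → asc e ≢ opp (asc e)
    asc≢opp e = source≢target (asc e) ∘ cong source

    to : E ⊎ E → Primitive
    to = [ asc , opp ∘ asc ]′

    from : Primitive → E ⊎ E
    from p = map⊎ (λ _ → edge p) (λ _ → edge p)
               (sameEdge p (asc (edge p)) (sym (asc-edge (edge p))))

    to-from : ∀ p → to (from p) ≡ p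
    to-from p with sameEdge p (asc (edge p)) (sym (asc-edge (edge p)))
    ... | inj₁ eq = sym eq
    ... | inj₂ eq = sym eq

    from-to : ∀ x → from (to x) ≡ x
    from-to (inj₁ e)
      with sameEdge (asc e) (asc (edge (asc e))) (sym (asc-edge (edge (asc e))))
    ... | inj₁ _  = cong inj₁ (asc-edge e)
    ... | inj₂ eq = contradiction (trans eq (cong (opp ∘ asc) (asc-edge e))) (asc≢opp e)
    from-to (inj₂ e)
      with sameEdge (opp (asc e)) (asc (edge (asc e))) (sym (asc-edge (edge (asc e))))
    ... | inj₁ eq = contradiction (sym (trans eq (cong asc (asc-edge e)))) (asc≢opp e)
    ... | inj₂ _  = cong inj₂ (asc-edge e)

  V↔Bool : ∀ p → (∀ v → v ≡ source p ⊎ v ≡ target p) → V ↔ Bool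
  V↔Bool p all = mk↔ₛ′ to from to-from from-to
    where
    to : V → Bool
    to v = does (v ≟ source p)

    from : Bool → V
    from b = if b then source p else target p

    to-from : ∀ b → to (from b) ≡ b
    to-from true  = dec-true (source p ≟ source p) refl
    to-from false = dec-false (target p ≟ source p) (source≢target p ∘ sym)

    from-to : ∀ v → from (to v) ≡ v
    from-to v with v ≟ source p | all v
    ... | yes s | _      = sym s
    ... | no ¬s | inj₁ s = contradiction s ¬s
    ... | no _  | inj₂ t = sym t

  complete⇒∈boundary : Connected G → Complete → ∀ v e → v ∈ boundary e
  complete⇒∈boundary connected complete v e with onEdge e
  ... | p , refl with complete⇒twoVertices connected complete p v
  ...   | inj₁ refl = source∈edge p
  ...   | inj₂ refl = source∈edge (opp p)

-- Graph isomorphisms from bijections of half-edges.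

-- An edge is sent to the image of its ascending half-edge: f need not respect
-- which of several parallel half-edges is the opposite of which.
build : ∀ G G′ → let module H = HalfEdges G; module H′ = HalfEdges G′ in
  Connected G → Connected G′ → H.Primitive → (f : H.Primitive ↔ H′.Primitive) →
  (∀ p q → H.source p ≡ H.source q ⇔
           H′.source (Inverse.to f p) ≡ H′.source (Inverse.to f q)) →
  (∀ p → H′.target (Inverse.to f p) ≡ H′.source (Inverse.to f (H.opp p))) →
  G ≅ᴳ G′
build G G′ connected connected′ p₀ f↔ f-source⇔ f-target = record
  { onV        = mk↔ₛ′ toV fromV toV-fromV fromV-toV
  ; onE        = mk↔ₛ′ toE fromE toE-fromE fromE-toE
  ; compatible = λ v e → mk⇔ (compatible→ v e) (compatible← v e)
  }
  where
  open HalfEdges G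
  module H′ = HalfEdges G′
  open Inverse f↔ using () renaming (to to f; from to g; strictlyInverseˡ to f∘g; strictlyInverseʳ to g∘f)

  f-source : ∀ {p q} → source p ≡ source q → H′.source (f p) ≡ H′.source (f q)
  f-source = Equivalence.to (f-source⇔ _ _)

  f-source⁻¹ : ∀ {p q} → H′.source (f p) ≡ H′.source (f q) → source p ≡ source q
  f-source⁻¹ = Equivalence.from (f-source⇔ _ _)

  out  = outgoing connected p₀
  out′ = H′.outgoing connected′ (f p₀)

  toV : V → H′.V
  toV v = H′.source (f (proj₁ (out v)))

  fromV : H′.V → V
  fromV v = source (g (proj₁ (out′ v)))

  toV-source : ∀ p → toV (source p) ≡ H′.source (f p)
  toV-source p = f-source {proj₁ (out (source p))} {p} (proj₂ (out (source p)))

  toV-fromV : ∀ v → toV (fromV v) ≡ v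
  toV-fromV v = trans (toV-source (g (proj₁ (out′ v))))
    (trans (cong H′.source (f∘g (proj₁ (out′ v)))) (proj₂ (out′ v)))

  fromV-toV : ∀ v → fromV (toV v) ≡ v
  fromV-toV v = trans
    (f-source⁻¹ {g (proj₁ (out′ (toV v)))} {proj₁ (out v)}
      (trans (cong H′.source (f∘g (proj₁ (out′ (toV v))))) (proj₂ (out′ (toV v)))))
    (proj₂ (out v))

  -- `f-target` turns each target into the source of an opposite, so crossing becomes two equalities
  -- of sources, which `f` reflects.
  f-crossed⁻¹ : ∀ p q → H′.Crossed (f p) (f q) → Crossed p q
  f-crossed⁻¹ p q (s , t) =
    f-source⁻¹ {p} {opp q} (trans s (f-target q)) ,
    f-source⁻¹ {opp p} {q} (trans (sym (f-target p)) t)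

  crossed-ascending : ∀ p q → Crossed p q → source p < target p → ¬ source q < target q
  crossed-ascending p q (s , t) p< q< =
    <-asym q< (subst₂ _<_ s t p<)

  toE : E → H′.E
  toE e = H′.edge (f (asc e))

  -- Distinct images on one edge are opposite, so `p` and `q` would cross and could not both ascend.
  f-ascending-injective : ∀ p q → source p < target p → source q < target q →
                          H′.edge (f p) ≡ H′.edge (f q) → p ≡ q
  f-ascending-injective p q p< q< e with H′.sameEdge (f p) (f q) e
  ... | inj₁ eq = trans (sym (g∘f p)) (trans (cong g eq) (g∘f q))
  ... | inj₂ eq = contradiction q< (crossed-ascending p q (f-crossed⁻¹ p q
    (subst (λ r → H′.Crossed r (f q)) (sym eq)
      (H′.crossed-sym (f q) (H′.opp (f q)) (H′.crossed-opp (f q))))) p<)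

  -- The preimages of the two half-edges of `e` cross, so one of them ascends.
  f-ascending-surjective : ∀ e → ∃ λ p → source p < target p × H′.edge (f p) ≡ e
  f-ascending-surjective e with H′.onEdge e
  ... | p′ , refl with <-cmp (source (g p′)) (target (g p′))
  ...   | tri< s<t _ _ = g p′ , s<t , cong H′.edge (f∘g p′)
  ...   | tri≈ _ s≡t _ = contradiction s≡t (source≢target (g p′))
  ...   | tri> _ _ t<s = g (H′.opp p′) , subst₂ _<_ t s t<s , cong H′.edge (f∘g (H′.opp p′))
    where
    crossed : Crossed (g p′) (g (H′.opp p′))
    crossed = f-crossed⁻¹ _ _
      (subst₂ H′.Crossed (sym (f∘g p′)) (sym (f∘g (H′.opp p′))) (H′.crossed-opp p′))
    s = proj₁ crossed
    t = proj₂ crossed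

  fromE : H′.E → E
  fromE e = edge (proj₁ (f-ascending-surjective e))

  toE-fromE : ∀ e → toE (fromE e) ≡ e
  toE-fromE e with f-ascending-surjective e
  ... | p , p< , eq = trans
    (cong (H′.edge ∘ f) (ascending-unique (asc (edge p)) p (asc-< (edge p)) p< (asc-edge (edge p)))) eq

  fromE-toE : ∀ e → fromE (toE e) ≡ e
  fromE-toE e with f-ascending-surjective (toE e)
  ... | p , p< , eq = trans
    (cong edge (f-ascending-injective p (asc e) p< (asc-< e) eq)) (asc-edge e)

  compatible→ : ∀ v e → v ∈ boundary e → toV v ∈ H′.boundary (toE e)
  compatible→ v e v∈e
    with ∈edge (asc e) (subst (λ e → v ∈ boundary e) (sym (asc-edge e)) v∈e)
  ... | inj₁ refl = subst (_∈ H′.boundary (toE e)) (sym (toV-source (asc e)))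
                      (H′.source∈edge (f (asc e)))
  ... | inj₂ refl = subst (_∈ H′.boundary (toE e))
                      (sym (trans (toV-source (opp (asc e))) (sym (f-target (asc e)))))
                      (H′.source∈edge (H′.opp (f (asc e))))

  compatible← : ∀ v e → toV v ∈ H′.boundary (toE e) → v ∈ boundary e
  compatible← v e v∈e = subst (λ e → v ∈ boundary e) (asc-edge e)
    ([ (λ eq → subst (_∈ boundary (edge (asc e)))
         (trans (sym (f-source⁻¹ {proj₁ (out v)} {asc e} eq)) (proj₂ (out v)))
         (source∈edge (asc e)))
     , (λ eq → subst (_∈ boundary (edge (asc e)))
         (trans (sym (f-source⁻¹ {proj₁ (out v)} {opp (asc e)} (trans eq (f-target (asc e)))))
           (proj₂ (out v)))
         (source∈edge (opp (asc e)))) ]′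
     (H′.∈edge (f (asc e)) v∈e))

-- Isomorphisms of the conflict relation.

module ConflictIso {G G′ : Multigraph}
  (connected : Connected G) (connected′ : Connected G′)
  (f↔ : HalfEdges.Primitive G ↔ HalfEdges.Primitive G′)
  (f-conflict : ∀ p q → HalfEdges.Conflict G p q ⇔
                        HalfEdges.Conflict G′ (Inverse.to f↔ p) (Inverse.to f↔ q))
  where

  open HalfEdges G
  module H′ = HalfEdges G′
  open Inverse f↔ using () renaming (to to f; from to g; strictlyInverseˡ to f∘g; strictlyInverseʳ to g∘f)

  f-conflict→ : ∀ p q → Conflict p q → H′.Conflict (f p) (f q)
  f-conflict→ p q = Equivalence.to (f-conflict p q)

  f-conflict← : ∀ p q → H′.Conflict (f p) (f q) → Conflict p q
  f-conflict← p q = Equivalence.from (f-conflict p q)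

  onto : ∀ {ℓ} (Q : Pred H′.Primitive ℓ) → (∀ p → Q (f p)) → ∀ p′ → Q p′
  onto Q Qf p′ = subst Q (f∘g p′) (Qf (g p′))

  complete→ : Complete → H′.Complete
  complete→ complete p′ q′ = onto (λ p′ → H′.Conflict p′ q′)
    (λ p → onto (H′.Conflict (f p)) (λ q → f-conflict→ p q (complete p q)) q′) p′

  complete← : H′.Complete → Complete
  complete← complete p q = f-conflict← p q (complete (f p) (f q))

  module NotComplete (¬complete : ¬ Complete) where

    -- Parallel half-edges are twins for conflict, `f` preserves twins, and twins are parallel in
    -- `G′` because it is not complete either.
    f-parallel→ : ∀ p q → Parallel p q → H′.Parallel (f p) (f q)
    f-parallel→ p q ∥ = H′.twin⇒parallel connected′ (¬complete ∘ complete←) (f p) (f q)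
      (onto _ λ r → mk⇔
        (λ c → f-conflict→ q r (parallel-conflict q p r (parallel-sym p q ∥) (f-conflict← p r c)))
        (λ c → f-conflict→ p r (parallel-conflict p q r ∥ (f-conflict← q r c))))

    f-parallel← : ∀ p q → H′.Parallel (f p) (f q) → Parallel p q
    f-parallel← p q ∥ = twin⇒parallel connected ¬complete p q λ r → mk⇔
      (λ c → f-conflict← q r (H′.parallel-conflict (f q) (f p) (f r)
               (H′.parallel-sym (f p) (f q) ∥) (f-conflict→ p r c)))
      (λ c → f-conflict← p r (H′.parallel-conflict (f p) (f q) (f r) ∥ (f-conflict→ q r c)))

    f-isolated→ : ∀ p q → Isolated p q → H′.Isolated (f p) (f q)
    f-isolated→ p q iso = onto _ λ r c c′ →
      map⊎ (f-parallel→ p r) (f-parallel→ q r) (iso r (f-conflict← p r c) (f-conflict← q r c′))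

    f-isolated← : ∀ p q → H′.Isolated (f p) (f q) → Isolated p q
    f-isolated← p q iso r c c′ = map⊎ (f-parallel← p r) (f-parallel← q r)
      (iso (f r) (f-conflict→ p r c) (f-conflict→ q r c′))

    -- `Straight` does not ask for `f (opp p) ≡ H′.opp (f p)`, which may fail among parallel edges.
    Straight Twisted : Pred Primitive 0ℓ
    Straight p = H′.Crossed (f p) (f (opp p))
    Twisted  p = H′.source (f p) ≡ H′.source (f (opp p))

    twisted⊎straight : ∀ p → Twisted p ⊎ Straight p
    twisted⊎straight p = f-conflict→ p (opp p) (inj₂ (crossed-opp p))

    straight-opp : ∀ p → Straight p → Straight (opp p)
    straight-opp p c = subst (λ q → H′.Crossed (f (opp p)) (f q)) (sym (opp-involutive p))
      (H′.crossed-sym (f p) (f (opp p)) c)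

    source≡∦opp : ∀ p q → source p ≡ source q → ¬ Parallel q (opp p)
    source≡∦opp p q s (s′ , _) = source≢target p (trans s s′)

    straight-¬crossed : ∀ p q → Straight p → source p ≡ source q → ¬ H′.Crossed (f p) (f q)
    straight-¬crossed p q straight s c = source≡∦opp p q s
      (f-parallel← q (opp p) (H′.crossed-crossed (f p) (f q) (f (opp p)) c straight))

    -- If `q` were twisted, `f p`, `f q` and `f (opp q)` would share a source, and isolation would
    -- make `f p` parallel to one of the other two. For `f (opp q)` this contradicts the position of
    -- `p`; for `f q` the straightness of `p` carries over to `q`.
    straight-around : ∀ p q → source p ≡ source q → Straight p → Straight q
    straight-around p q s straight with twisted⊎straight q
    ... | inj₂ straight′ = straight′
    ... | inj₁ twisted with f-conflict→ p q (inj₁ s)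
    ...   | inj₂ c  = contradiction c (straight-¬crossed p q straight s)
    ...   | inj₁ s′ with f-isolated→ q (opp q) (crossed⇒isolated q (opp q) (crossed-opp q))
                           (f p) (inj₁ (sym s′)) (inj₁ (sym (trans s′ twisted)))
    ...     | inj₂ ∥ = contradiction (parallel-sym (opp q) p (f-parallel← (opp q) p ∥))
                         (source≡∦opp q p (sym s))
    ...     | inj₁ ∥ = H′.parallel-crossed (f q) (f p) (f (opp q)) ∥
                (H′.crossed-sym (f (opp q)) (f p)
                  (H′.parallel-crossed (f (opp q)) (f (opp p)) (f p)
                    (f-parallel→ (opp q) (opp p) (parallel-opp q p (f-parallel← q p ∥)))
                    (H′.crossed-sym (f p) (f (opp p)) straight)))

    straight-everywhere : ∀ p q → Straight p → Straight q
    straight-everywhere = halfEdge-induction connected Straight straight-around straight-opp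

    straight⇒≅ : ∀ p → Straight p → G ≅ᴳ G′
    straight⇒≅ p₀ straight₀ = build G G′ connected connected′ p₀ f↔
      (λ p q → mk⇔ (source→ p q) (source← p q)) (λ p → proj₂ (straight p))
      where
      straight : ∀ p → Straight p
      straight p = straight-everywhere p₀ p straight₀

      source→ : ∀ p q → source p ≡ source q → H′.source (f p) ≡ H′.source (f q)
      source→ p q s with f-conflict→ p q (inj₁ s)
      ... | inj₁ s′ = s′
      ... | inj₂ c  = contradiction c (straight-¬crossed p q (straight p) s)

      source← : ∀ p q → H′.source (f p) ≡ H′.source (f q) → source p ≡ source q
      source← p q s′ with f-conflict← p q (inj₁ s′)
      ... | inj₁ s = s
      ... | inj₂ c = contradiction s′ (H′.crossed⇒source≢ (f p) (f q)
        (H′.crossed-sym (f q) (f p) (H′.parallel-crossed (f q) (f (opp p)) (f p)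
          (f-parallel→ q (opp p) (crossed-crossed p q (opp p) c (crossed-opp p)))
          (H′.crossed-sym (f p) (f (opp p)) (straight p)))))

    -- The twisted case: cycles.

    module AllTwisted (p₀ : Primitive) (twisted : ∀ p → Twisted p) where

      -- The reversal in `G′` pulled back along `f`; in `G` it moves across a vertex.
      turn : Primitive → Primitive
      turn p = g (H′.opp (f p))

      abstract
        f-turn : ∀ p → f (turn p) ≡ H′.opp (f p)
        f-turn p = f∘g (H′.opp (f p))

        f-turn-crossed : ∀ p → H′.Crossed (f p) (f (turn p))
        f-turn-crossed p = subst (H′.Crossed (f p)) (sym (f-turn p)) (H′.crossed-opp (f p))

        turn-involutive : ∀ p → turn (turn p) ≡ p
        turn-involutive p = trans (cong (g ∘ H′.opp) (f-turn p))
          (trans (cong g (H′.opp-involutive (f p))) (g∘f p))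

        turn-parallel : ∀ p q → Parallel p q → Parallel (turn p) (turn q)
        turn-parallel p q ∥ = f-parallel← (turn p) (turn q)
          (subst₂ H′.Parallel (sym (f-turn p)) (sym (f-turn q))
            (H′.parallel-opp (f p) (f q) (f-parallel→ p q ∥)))

        -- The images cross, so `p` and `turn p` conflict. If they crossed, `turn p` would be
        -- parallel to `opp p`, whose image shares its source with `f p` by twistedness.
        turn-source : ∀ p → source p ≡ source (turn p)
        turn-source p with f-conflict← p (turn p) (inj₂ (f-turn-crossed p))
        ... | inj₁ s = s
        ... | inj₂ c = contradiction (trans (twisted p) (proj₁ opp∥turn))
                         (H′.crossed⇒source≢ (f p) (f (turn p)) (f-turn-crossed p))
          where
          opp∥turn : H′.Parallel (f (opp p)) (f (turn p))
          opp∥turn = f-parallel→ (opp p) (turn p) (crossed-crossed p (opp p) (turn p) (crossed-opp p) c)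

        turn-∦ : ∀ p → ¬ Parallel p (turn p)
        turn-∦ p ∥ = H′.crossed⇒source≢ (f p) (f (turn p)) (f-turn-crossed p)
          (proj₁ (f-parallel→ p (turn p) ∥))

        -- The pair `p`, `turn p` is isolated because its images cross, and `q` conflicts with both
        -- by sharing their source. Thus a vertex has only two neighbours.
        two-classes : ∀ p q → source p ≡ source q → Parallel p q ⊎ Parallel (turn p) q
        two-classes p q s = f-isolated← p (turn p)
          (H′.crossed⇒isolated (f p) (f (turn p)) (f-turn-crossed p))
          q (inj₁ s) (inj₁ (trans (sym (turn-source p)) s))

        two-classes′ : ∀ p q → H′.source (f p) ≡ H′.source (f q) → Parallel p q ⊎ Parallel (opp p) q
        two-classes′ p q s = map⊎ (f-parallel← p q) (f-parallel← (opp p) q)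
          (f-isolated→ p (opp p) (crossed⇒isolated p (opp p) (crossed-opp p))
            (f q) (inj₁ s) (inj₁ (trans (sym (twisted p)) s)))

      open Parity connected p₀ turn turn-involutive turn-parallel turn-∦ two-classes

      -- The condition on targets that `build` needs for `f ∘ shift`. In either parity `shift p` and
      -- `shift (opp p)` differ by a `turn`, which `f` sends to a reversal.
      shift-opp : ∀ p → H′.target (f (shift p)) ≡ H′.source (f (shift (opp p)))
      shift-opp p with parity p
      ... | inj₁ even = trans (proj₂ (f-turn-crossed (opp p)))
        (cong (H′.source ∘ f) (sym (shift-odd even)))
      ... | inj₂ odd = trans (sym (proj₁ (f-turn-crossed p)))
        (cong (H′.source ∘ f) (sym (trans (shift-even (odd-opp p odd)) (opp-involutive p))))

      shift-parallel : ∀ p q → Parallel p q → Parallel (shift p) (shift q)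
      shift-parallel p q ∥ with parity p
      ... | inj₁ even = subst (Parallel (opp p)) (sym (shift-even (even-∥ p q ∥ even)))
                          (parallel-opp p q ∥)
      ... | inj₂ odd  = subst (Parallel (turn p)) (sym (shift-odd (odd-∥ p q ∥ odd)))
                          (turn-parallel p q ∥)

      -- In either parity the two shifted half-edges differ by `opp`, and twistedness identifies the
      -- sources of their images.
      shift-turn : ∀ p → H′.source (f (shift p)) ≡ H′.source (f (shift (turn p)))
      shift-turn p with parity p
      ... | inj₁ even = trans (sym (twisted p)) (cong (H′.source ∘ f)
        (sym (trans (shift-odd (even-turn p even)) (turn-involutive p))))
      ... | inj₂ odd = trans (twisted (turn p)) (cong (H′.source ∘ f)
        (sym (shift-even (odd-turn p odd))))

      source→ : ∀ p q → source p ≡ source q → H′.source (f (shift p)) ≡ H′.source (f (shift q))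
      source→ p q s with two-classes p q s
      ... | inj₁ ∥ = proj₁ (f-parallel→ _ _ (shift-parallel p q ∥))
      ... | inj₂ ∥ = trans (shift-turn p)
        (proj₁ (f-parallel→ _ _ (shift-parallel (turn p) q ∥)))

      -- Shifting changes parity and parallelism keeps it, so `p` and `q` have equal parity and
      -- undergo the same move.
      shift-parallel← : ∀ p q → Parallel (shift p) (shift q) → source p ≡ source q
      shift-parallel← p q ∥ with parity p | parity q
      ... | inj₁ _    | inj₁ _    = trans (sym (target-opp p)) (trans (proj₂ ∥) (target-opp q))
      ... | inj₂ _    | inj₂ _    = trans (turn-source p) (trans (proj₁ ∥) (sym (turn-source q)))
      ... | inj₁ even | inj₂ odd  =
        contradiction (even-opp p even) (even⇒¬odd _ (even-∥ _ _ (parallel-sym _ _ ∥) (odd-turn q odd)))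
      ... | inj₂ odd  | inj₁ even =
        contradiction (even-opp q even) (even⇒¬odd _ (even-∥ _ _ ∥ (odd-turn p odd)))

      -- The extra `opp` changes parity once more, so here `p` and `q` have different parities.
      shift-parallel-opp← : ∀ p q → Parallel (opp (shift p)) (shift q) → source p ≡ source q
      shift-parallel-opp← p q ∥ with parity p | parity q
      ... | inj₁ _ | inj₂ _ = trans (cong source (sym (opp-involutive p)))
                                (trans (proj₁ ∥) (sym (turn-source q)))
      ... | inj₂ _ | inj₁ _ = trans (turn-source p) (trans (sym (target-opp (turn p)))
                                (trans (proj₂ ∥) (target-opp q)))
      ... | inj₁ even | inj₁ even′ = contradiction (even-opp q even′)
        (even⇒¬odd _ (even-∥ _ _ ∥ (odd-opp (opp p) (even-opp p even))))
      ... | inj₂ odd  | inj₂ odd′ = contradiction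
        (odd-∥ _ _ ∥ (even-opp (turn p) (odd-turn p odd)))
        (even⇒¬odd _ (odd-turn q odd′))

      source← : ∀ p q → H′.source (f (shift p)) ≡ H′.source (f (shift q)) → source p ≡ source q
      source← p q s =
        [ shift-parallel← p q , shift-parallel-opp← p q ]′ (two-classes′ (shift p) (shift q) s)

      twisted⇒≅ : G ≅ᴳ G′
      twisted⇒≅ = build G G′ connected connected′ p₀ (f↔ ↔-∘ shift-↔)
        (λ p q → mk⇔ (source→ p q) (source← p q)) shift-opp

    notComplete⇒≅ : Primitive → G ≅ᴳ G′
    notComplete⇒≅ p₀ with twisted⊎straight p₀
    ... | inj₂ straight = straight⇒≅ p₀ straight
    ... | inj₁ twisted₀ = AllTwisted.twisted⇒≅ p₀ twisted
      where
      twisted : ∀ p → Twisted p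
      twisted p with twisted⊎straight p
      ... | inj₁ twisted = twisted
      ... | inj₂ straight = contradiction twisted₀
        (H′.crossed⇒source≢ (f p₀) (f (opp p₀)) (straight-everywhere p p₀ straight))

  -- Complete and edgeless graphs.

  complete⇒≅ : Primitive → Complete → G ≅ᴳ G′
  complete⇒≅ p₀ complete = record
    { onV        = ↔-sym (H′.V↔Bool (f p₀) (H′.complete⇒twoVertices connected′ complete′ (f p₀)))
                   ↔-∘ V↔Bool p₀ (complete⇒twoVertices connected complete p₀)
    ; onE        = subst (λ n → E ↔ Fin n) #E≡#E′ (↔-id E)
    -- Each edge contains both of the two vertices, so any pair of bijections is compatible.
    ; compatible = λ v e → mk⇔ (λ _ → H′.complete⇒∈boundary connected′ complete′ _ _)
                               (λ _ → complete⇒∈boundary connected complete v e)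
    }
    where
    complete′ : H′.Complete
    complete′ = complete→ complete

    #E≡#E′ : #E ≡ H′.#E
    #E≡#E′ = *-cancelˡ-≡ #E H′.#E 2
      (subst₂ (λ m n → #E + m ≡ H′.#E + n) (sym (+-identityʳ #E)) (sym (+-identityʳ H′.#E))
        (↔⇒≡ (↔-sym +↔⊎ ↔-∘ (↔-sym H′.E⊎E↔Primitive ↔-∘ (f↔ ↔-∘ (E⊎E↔Primitive ↔-∘ +↔⊎))))))

  noHalfEdge⇒≅ : ¬ Primitive → G ≅ᴳ G′
  noHalfEdge⇒≅ none = record
    { onV        = mk↔ₛ′ (λ _ → proj₁ connected′) (λ _ → proj₁ connected)
                     (H′.noHalfEdge⇒V-unique connected′ none′ (proj₁ connected′))
                     (noHalfEdge⇒V-unique connected none (proj₁ connected))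
    ; onE        = mk↔ₛ′ (λ e → contradiction e noEdge) (λ e → contradiction e noEdge′)
                     (λ e → contradiction e noEdge′) (λ e → contradiction e noEdge)
    ; compatible = λ _ e → contradiction e noEdge
    }
    where
    none′ : ¬ H′.Primitive
    none′ = none ∘ g

    noEdge : ¬ E
    noEdge e = none (proj₁ (onEdge e))

    noEdge′ : ¬ H′.E
    noEdge′ e = none′ (proj₁ (H′.onEdge e))

  G≅G′ : G ≅ᴳ G′
  G≅G′ with halfEdge?
  ... | no none = noHalfEdge⇒≅ none
  ... | yes p₀ with all? (λ v → v ≟ source p₀ ⊎-dec v ≟ target p₀)
  ...   | yes two = complete⇒≅ p₀ (twoVertices⇒complete p₀ two)
  ...   | no ¬two = NotComplete.notComplete⇒≅
                      (λ complete → ¬two (complete⇒twoVertices connected complete p₀)) p₀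

-- From Morse complexes to the conflict relation.

module _ (G G′ : Multigraph) (iso : 𝔐 G ≅ 𝔐 G′) where
  private
    module H  = HalfEdges G
    module H′ = HalfEdges G′
  open _≅_ iso
  open Inverse onVertex using () renaming (to to f; strictlyInverseʳ to g∘f)

  -- Only two-element lists matter: for distinct half-edges, conflict is the complement of spanning
  -- a simplex. Non-conflict implies distinctness by reflexivity, and decidability removes the
  -- double negation.
  ≅⇒conflict : ∀ p q → H.Conflict p q ⇔ H′.Conflict (f p) (f q)
  ≅⇒conflict p q = mk⇔
    (λ c → decidable-stable (H′.conflict? (f p) (f q)) λ ¬c′ →
      H.morse⇒¬conflict (λ { refl → ¬c′ (inj₁ refl) })
        (Equivalence.from (onSimplex (p ∷ q ∷ [])) (H′.¬conflict⇒morse (f p) (f q) ¬c′)) c)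
    (λ c′ → decidable-stable (H.conflict? p q) λ ¬c →
      H′.morse⇒¬conflict (λ eq → ¬c (inj₁ (cong H.source (f-injective eq))))
        (Equivalence.to (onSimplex (p ∷ q ∷ [])) (H.¬conflict⇒morse p q ¬c)) c′)
    where
    f-injective : f p ≡ f q → p ≡ q
    f-injective eq = trans (sym (g∘f p)) (trans (cong (Inverse.from onVertex) eq) (g∘f q))

theoremB : (G G′ : Multigraph) → Connected G → Connected G′ → 𝔐 G ≅ 𝔐 G′ → G ≅ᴳ G′
theoremB G G′ connected connected′ iso =
  ConflictIso.G≅G′ connected connected′ (_≅_.onVertex iso) (≅⇒conflict G G′ iso)
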